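{- Let $k\ge2$ and let $x$ be an irrational real number whose continued fraction expansion $[a_0,a_1,a_2,\ldots]$ is $k$-automatic. Then the continued fraction expansions of both $\liminf_{n\to\infty}T^n(x)$ and $\limsup_{n\to\infty}T^n(x)$ are $k$-automatic.
   Context: A continued fraction expansion $[a_0,a_1,\ldots]$ is called $k$-automatic if its partial quotients are bounded and the sequence $(a_i)_{i\ge0}$ (over the finite set of values taken) is $k$-automatic, i.e., there is a deterministic finite automaton with output $M=(Q,\{0,\ldots,k-1\},\Delta,\delta,q_0,\tau)$ with $a_n=\tau(\delta(q_0,w^R))$ for every base-$k$ representation $w$ of $n$ (leading zeros allowed), $w^R$ the reversal of $w$. $T$ is the Gauss-type map $T(y)=1/(y-\lfloor y\rfloor)$, so that $T([a_0,a_1,a_2,\ldots])=[a_1,a_2,\ldots]$. -}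

module Defs where

open import Data.Nat using (ℕ; zero; suc; _+_; _*_; _≤_; _<_; _%_)
open import Data.Integer using (ℤ; +_; ∣_∣) renaming (_≤_ to _≤ℤ_; _<_ to _<ℤ_)
open import Data.Fin using (Fin; toℕ)
open import Data.List using (List; foldl; reverse)
open import Data.Product using (Σ; ∃; _×_)
open import Relation.Binary.PropositionalEquality using (_≡_)

-- An irrational real number is represented by its (unique, infinite)
-- continued fraction expansion [a₀,a₁,…] with a₀ ∈ ℤ and aᵢ ≥ 1 for i ≥ 1.
IsCF : (ℕ → ℤ) → Set
IsCF a = (i : ℕ) → 1 ≤ i → + 1 ≤ℤ a i

-- Order of irrational reals, read off their continued fractions:
-- [a₀,a₁,…] < [b₀,b₁,…] iff at the first index i where they differ,
-- aᵢ < bᵢ if i is even, and aᵢ > bᵢ if i is odd.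
_<cf_ : (ℕ → ℤ) → (ℕ → ℤ) → Set
a <cf b = ∃ λ i → ((j : ℕ) → j < i → a j ≡ b j) × LtAt i
  where
  LtAt : ℕ → Set
  LtAt i with i % 2
  ... | zero  = a i <ℤ b i
  ... | suc _ = b i <ℤ a i

shift : ℕ → (ℕ → ℤ) → (ℕ → ℤ)
shift n a i = a (n + i)

-- y = liminf_{n→∞} Tⁿ(x), where x has CF a and y is irrational with CF y.
-- (Test points z range over irrationals, which are dense in ℝ.)
IsLiminfT : (ℕ → ℤ) → (ℕ → ℤ) → Set
IsLiminfT a y =
  ((z : ℕ → ℤ) → IsCF z → z <cf y → ∃ λ N → (n : ℕ) → N ≤ n → z <cf shift n a)
  × ((z : ℕ → ℤ) → IsCF z → y <cf z → (N : ℕ) → ∃ λ n → N ≤ n × shift n a <cf z)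

IsLimsupT : (ℕ → ℤ) → (ℕ → ℤ) → Set
IsLimsupT a y =
  ((z : ℕ → ℤ) → IsCF z → y <cf z → ∃ λ N → (n : ℕ) → N ≤ n → shift n a <cf z)
  × ((z : ℕ → ℤ) → IsCF z → z <cf y → (N : ℕ) → ∃ λ n → N ≤ n × z <cf shift n a)

-- value of a base-k digit word, most significant digit first (leading zeros allowed)
val : (k : ℕ) → List (Fin k) → ℕ
val k = foldl (λ acc d → acc * k + toℕ d) 0

record DFAO (k : ℕ) (Out : Set) : Set where
  field
    m  : ℕ
    δ  : Fin m → Fin k → Fin m
    q₀ : Fin m
    τ  : Fin m → Out

run : ∀ {k m} → (Fin m → Fin k → Fin m) → Fin m → List (Fin k) → Fin m
run δ = foldl δ

IsAutomatic : (k : ℕ) → (ℕ → ℤ) → Set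
IsAutomatic k a = Σ (DFAO k ℤ) λ M →
  (w : List (Fin k)) → a (val k w) ≡ DFAO.τ M (run (DFAO.δ M) (DFAO.q₀ M) (reverse w))

Bounded : (ℕ → ℤ) → Set
Bounded a = ∃ λ B → (i : ℕ) → ∣ a i ∣ ≤ B

AutomaticCF : ℕ → (ℕ → ℤ) → Set
AutomaticCF k a = Bounded a × IsAutomatic k a

{-# OPTIONS --safe #-}

-- For each n the factors of length n that occur infinitely often in a have a least one in the
-- alternating lexicographic order, and these least factors are the prefixes of the liminf y.
-- Hence y n ≡ x is a first-order property of n over (ℕ, <, parity, i t ↦ a (i + t)), and
-- predicates with a finite k-kernel are closed under all first-order operations; they are
-- moreover decidable, which supplies the case distinctions (infinitely often or not) needed
-- for the existence of the least factors.

module Submission where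

open import Defs
open import Data.Bool using (Bool; true; false; not; _∧_; _∨_; if_then_else_)
import Data.Bool.Properties as Bool
open import Data.Empty using (⊥-elim)
open import Data.Fin using (Fin; zero; suc; toℕ; fromℕ<; combine; remQuot)
import Data.Fin.Properties as Fin
open import Data.Fin.Induction using (spo-wellFounded)
open import Data.Integer using (ℤ; ∣_∣; 0ℤ) renaming (_<_ to _<ℤ_; _≤_ to _≤ℤ_)
import Data.Integer.Properties as ℤ
open import Data.List using (List; []; _∷_; _++_; [_]; foldl; foldr; reverse)
import Data.List.Properties as List
open import Data.Nat
open import Data.Nat.DivMod
open import Data.Nat.Divisibility using (n∣m*n)
open import Data.Nat.GeneralisedArithmetic using (fold; fold-+)
open import Data.Nat.Properties
open import Data.Nat.Solver using (module +-*-Solver)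
open import Data.Product using (Σ; ∃; _×_; _,_; proj₁; proj₂)
open import Data.Sum using (_⊎_; inj₁; inj₂)
open import Data.Unit using (⊤; tt)
open import Data.Vec using (Vec; []; _∷_; lookup; tabulate)
open import Data.Vec.Properties using (lookup∘tabulate)
open import Function using (_∘_; flip; _on_; _⇔_; mk⇔; Equivalence)
open import Induction.WellFounded using (Acc; acc)
open import Relation.Binary using (IsStrictTotalOrder; tri<; tri≈; tri>)
import Relation.Binary.Construct.Flip.EqAndOrd as Flip
import Relation.Binary.Construct.On as On
open import Relation.Binary.PropositionalEquality hiding ([_])
open import Relation.Nullary using (¬_; Dec; yes; no; does; contradiction)
open import Relation.Nullary.Decidable
  using (_×-dec_; _→-dec_; ¬?; does-⇔; map′; decidable-stable; dec-true)
open import Relation.Unary using (Decidable)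

-- Quantifiers may range over numbers only. A factor is therefore named by a position i at which it
-- occurs, and agreement and comparison of factors become bounded statements about `a (i + t)`. This
-- is what calls for an automaton that adds, and for parity, which fixes the direction of the
-- comparison at index t. Letters are named by positions too, or by one of the finitely many values
-- of a.
--
-- Automaticity is expressed by functions on numbers: a state q stands for a function `F q`, and
-- digits are split off, least significant first, by n = n / k * k + n mod k. Words occur only where
-- a `DFAO` is translated into this form or back. Excluded middle is not assumed, so each predicate
-- carries its decision procedure together with an automaton computing its Boolean.
--
-- The least factors of different lengths fit together because truncating one gives the least factor
-- of the shorter length, and there is only one for each length.

Tup : Set → ℕ → Set
Tup A zero    = ⊤
Tup A (suc d) = A × Tup A d

-- Finite sets, orbits and eventual behaviour.

record Finite (Q : Set) : Set where
  field
    size    : ℕ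
    to      : Fin size → Q
    from    : Q → Fin size
    to-from : ∀ q → to (from q) ≡ q

Fin-finite : ∀ {n} → Finite (Fin n)
Fin-finite {n} = record { size = n ; to = λ i → i ; from = λ i → i ; to-from = λ _ → refl }

×-finite : ∀ {A B} → Finite A → Finite B → Finite (A × B)
×-finite A B = record
  { size    = A.size * B.size
  ; to      = λ i → let (p , q) = remQuot B.size i in A.to p , B.to q
  ; from    = λ (a , b) → combine (A.from a) (B.from b)
  ; to-from = λ (a , b) → trans
      (cong (λ (p , q) → A.to p , B.to q) (Fin.remQuot-combine (A.from a) (B.from b)))
      (cong₂ _,_ (A.to-from a) (B.to-from b))
  }
  where module A = Finite A
        module B = Finite B

retract-finite : ∀ {A B : Set} (f : A → B) (g : B → A) → (∀ b → f (g b) ≡ b) → Finite A → Finite B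
retract-finite f g fg A = record
  { size = A.size ; to = f ∘ A.to ; from = A.from ∘ g
  ; to-from = λ b → trans (cong f (A.to-from (g b))) (fg b) }
  where module A = Finite A

Bool-finite : Finite Bool
Bool-finite = retract-finite
  (λ { zero → false ; (suc _) → true })
  (λ { false → zero ; true → suc zero })
  (λ { false → refl ; true → refl })
  (Fin-finite {2})

Vec-finite : ∀ {A} → Finite A → ∀ n → Finite (Vec A n)
Vec-finite A zero    = retract-finite (λ _ → []) (λ _ → zero) (λ { [] → refl }) (Fin-finite {1})
Vec-finite A (suc n) = retract-finite
  (λ (x , xs) → x ∷ xs) (λ { (x ∷ xs) → x , xs }) (λ { (x ∷ xs) → refl })
  (×-finite A (Vec-finite A n))

does⇒ : ∀ {B : Set} (B? : Dec B) → does B? ≡ true → B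
does⇒ (yes b) _ = b

fold-suc : ∀ {Q : Set} (x : Q) g n → fold (g x) g n ≡ fold x g (suc n)
fold-suc x g zero    = refl
fold-suc x g (suc n) = cong g (fold-suc x g n)

-- An orbit in a finite set repeats itself within the first size + 1 steps.
orbit? : ∀ {Q} → Finite Q → (g : Q → Q) {A : Q → Set} → Decidable A → ∀ x →
         Dec (∃ λ n → A (fold x g n))
orbit? Q g {A} A? x = map′ (λ (i , p) → toℕ i , p) (λ (n , p) → search n n ≤-refl p)
                           (Fin.any? λ i → A? (fold x g (toℕ i)))
  where
  module Q = Finite Q

  orbit : ℕ → _
  orbit = fold x g

  cycle : ∃ λ p → ∃ λ q → p < q × q ≤ Q.size × orbit p ≡ orbit q
  cycle with Fin.pigeonhole (n<1+n Q.size) (λ i → Q.from (orbit (toℕ i)))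
  ... | i , j , i<j , eq = toℕ i , toℕ j , i<j , ≤-pred (Fin.toℕ<n j) ,
        trans (sym (Q.to-from _)) (trans (cong Q.to eq) (Q.to-from _))

  search : ∀ b n → n ≤ b → A (orbit n) → ∃ λ (i : Fin (suc Q.size)) → A (orbit (toℕ i))
  search b n n≤b An with n <? suc Q.size
  ... | yes n<s = fromℕ< n<s , subst (A ∘ orbit) (sym (Fin.toℕ-fromℕ< n<s)) An
  search zero n n≤b An | no n≮s = contradiction (s≤s (≤-trans n≤b z≤n)) n≮s
  search (suc b) n n≤b An | no n≮s with cycle
  -- Cutting one turn of the cycle out of the first n steps keeps the endpoint and lowers n, so the
  -- fuel b may drop.
  ... | p , q , p<q , q≤s , eq = search b (n ∸ q + p) shorter (subst A same An)
    where
    q≤n : q ≤ n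
    q≤n = ≤-trans q≤s (≤-trans (n≤1+n _) (≮⇒≥ n≮s))

    shorter : n ∸ q + p ≤ b
    shorter = ≤-pred (≤-trans (≤-trans (+-monoʳ-< (n ∸ q) p<q) (≤-reflexive (m∸n+n≡m q≤n))) n≤b)

    same : orbit n ≡ orbit (n ∸ q + p)
    same = begin
      orbit n                      ≡⟨ cong orbit (m∸n+n≡m q≤n) ⟨
      orbit (n ∸ q + q)            ≡⟨ fold-+ x g (n ∸ q) ⟩
      fold (orbit q) g (n ∸ q)     ≡⟨ cong (λ y → fold y g (n ∸ q)) eq ⟨
      fold (orbit p) g (n ∸ q)     ≡⟨ fold-+ x g (n ∸ q) ⟨
      orbit (n ∸ q + p)            ∎
      where open ≡-Reasoning

InfOften : (ℕ → Set) → Set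
InfOften P = ∀ N → ∃ λ n → N ≤ n × P n

Eventually : (ℕ → Set) → Set
Eventually P = ∃ λ N → ∀ n → N ≤ n → P n

eventually-∀ : ∀ m {P : Fin m → ℕ → Set} → (∀ q → Eventually (P q)) →
               Eventually (λ n → ∀ q → P q n)
eventually-∀ zero    ev = 0 , λ _ _ ()
eventually-∀ (suc m) ev with ev zero | eventually-∀ m (ev ∘ suc)
... | N₀ , p₀ | N , p = N₀ ⊔ N , λ
  { n le zero    → p₀ n (m⊔n≤o⇒m≤o N₀ N le)
  ; n le (suc q) → p n (m⊔n≤o⇒n≤o N₀ N le) q }

-- Lexicographic order with a letter order that depends on the index.

module Lexicographic (_≺[_]_ : ℤ → ℕ → ℤ → Set)
                     (isStrictTotalOrder : ∀ t → IsStrictTotalOrder _≡_ (λ x y → x ≺[ t ] y)) where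

  module ≺ t = IsStrictTotalOrder (isStrictTotalOrder t)

  Seq = ℕ → ℤ

  Agree : Seq → Seq → ℕ → Set
  Agree u v n = ∀ t → t < n → u t ≡ v t

  _⊏_ : Seq → Seq → Set
  u ⊏ v = ∃ λ t → Agree u v t × u t ≺[ t ] v t

  -- Unlike `⊏`, this depends only on the first n terms, so it transfers along `Agree` up to n.
  Less : Seq → Seq → ℕ → Set
  Less u v n = ∃ λ t → t < n × Agree u v t × u t ≺[ t ] v t

  agree-sym : ∀ {u v n} → Agree u v n → Agree v u n
  agree-sym uv t t<n = sym (uv t t<n)

  agree-trans : ∀ {u v w n} → Agree u v n → Agree v w n → Agree u w n
  agree-trans uv vw t t<n = trans (uv t t<n) (vw t t<n)

  agree-≤ : ∀ {u v m n} → m ≤ n → Agree u v n → Agree u v m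
  agree-≤ m≤n uv t t<m = uv t (<-≤-trans t<m m≤n)

  agree-suc : ∀ {u v n} → Agree u v n → u n ≡ v n → Agree u v (suc n)
  agree-suc uv eq t t<1+n with m≤n⇒m<n∨m≡n (≤-pred t<1+n)
  ... | inj₁ t<n  = uv t t<n
  ... | inj₂ refl = eq

  less-≤ : ∀ {u v m n} → m ≤ n → Less u v m → Less u v n
  less-≤ m≤n (t , t<m , uv , lt) = t , <-≤-trans t<m m≤n , uv , lt

  less-respˡ : ∀ {u u′ v n} → Agree u u′ n → Less u v n → Less u′ v n
  less-respˡ uu′ (t , t<n , uv , lt) =
    t , t<n , agree-trans (agree-sym (agree-≤ (<⇒≤ t<n) uu′)) uv ,
    subst (_≺[ t ] _) (uu′ t t<n) lt

  less-respʳ : ∀ {u v v′ n} → Agree v v′ n → Less u v n → Less u v′ n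
  less-respʳ vv′ (t , t<n , uv , lt) =
    t , t<n , agree-trans uv (agree-≤ (<⇒≤ t<n) vv′) , subst (_ ≺[ t ]_) (vv′ t t<n) lt

  trichotomy : ∀ u v n → Agree u v n ⊎ Less u v n ⊎ Less v u n
  trichotomy u v zero = inj₁ λ _ ()
  trichotomy u v (suc n) with trichotomy u v n
  ... | inj₂ (inj₁ lt) = inj₂ (inj₁ (less-≤ (n≤1+n n) lt))
  ... | inj₂ (inj₂ gt) = inj₂ (inj₂ (less-≤ (n≤1+n n) gt))
  ... | inj₁ uv with ≺.compare n (u n) (v n)
  ...   | tri< lt _ _ = inj₂ (inj₁ (n , ≤-refl , uv , lt))
  ...   | tri≈ _ eq _ = inj₁ (agree-suc uv eq)
  ...   | tri> _ _ gt = inj₂ (inj₂ (n , ≤-refl , agree-sym uv , gt))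

  less-suc : ∀ {u v n} → Less u v (suc n) → Less u v n ⊎ (Agree u v n × u n ≺[ n ] v n)
  less-suc (t , t<1+n , uv , lt) with m≤n⇒m<n∨m≡n (≤-pred t<1+n)
  ... | inj₁ t<n  = inj₁ (t , t<n , uv , lt)
  ... | inj₂ refl = inj₂ (uv , lt)

  ⊏-less-trans : ∀ {u v w n} → u ⊏ v → Less v w n → u ⊏ w
  ⊏-less-trans {u} (s , uv , lt) (t , _ , vw , lt′) with <-cmp s t
  ... | tri< s<t _ _  = s , agree-trans uv (agree-≤ (<⇒≤ s<t) vw) , subst (u s ≺[ s ]_) (vw s s<t) lt
  ... | tri≈ _ refl _ = s , agree-trans uv vw , ≺.trans s lt lt′
  ... | tri> _ _ t<s  = t , agree-trans (agree-≤ (<⇒≤ t<s) uv) vw ,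
                        subst (_≺[ t ] _) (sym (uv t t<s)) lt′

  -- The positions satisfying G may be unbounded, so the descent runs on an index of the value
  -- `f p`: pulled back along `values`, the letter order is a strict partial order on `Fin m`, hence
  -- well-founded.
  minimum : ∀ t {m} (values : Fin m → ℤ) (f : Seq) → (∀ p → ∃ λ s → f p ≡ values s) →
            (G : ℕ → Set) → (∀ q → Dec (∃ λ p → G p × f p ≺[ t ] f q)) → ∃ G →
            ∃ λ q → G q × ¬ (∃ λ p → G p × f p ≺[ t ] f q)
  minimum t values f f-values G smaller? (p , Gp) =
    descend p Gp (spo-wellFounded (On.isStrictPartialOrder values (≺.isStrictPartialOrder t)) _)
            (proj₂ (f-values p))
    where
    descend : ∀ p → G p → ∀ {s} → Acc ((λ x y → x ≺[ t ] y) on values) s → f p ≡ values s →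
              ∃ λ q → G q × ¬ (∃ λ p → G p × f p ≺[ t ] f q)
    descend p Gp (acc rec) eq with smaller? p
    ... | no minimal = p , Gp , minimal
    ... | yes (q , Gq , lt) = let (s′ , eq′) = f-values q in
      descend q Gq (rec (subst₂ (_≺[ t ]_) eq′ eq lt)) eq′

-- Base-k digits and automatic functions.

module Automata (k : ℕ) {{k≥2 : NonTrivial k}} where

  instance
    k≢0 : NonZero k
    k≢0 = nonTrivial⇒nonZero k

  𝟘 : ∀ d → Tup ℕ d
  𝟘 zero    = tt
  𝟘 (suc d) = 0 , 𝟘 d

  0ᵈ : Fin k
  0ᵈ = 0 mod k

  𝟘ᵈ : ∀ d → Tup (Fin k) d
  𝟘ᵈ zero    = tt
  𝟘ᵈ (suc d) = 0ᵈ , 𝟘ᵈ d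

  -- Appends one least significant digit to every component.
  sh : ∀ d → Tup (Fin k) d → Tup ℕ d → Tup ℕ d
  sh zero    _        _        = tt
  sh (suc d) (r , rs) (n , ns) = n * k + toℕ r , sh d rs ns

  quo : ∀ d → Tup ℕ d → Tup ℕ d
  quo zero    _        = tt
  quo (suc d) (n , ns) = n / k , quo d ns

  rem : ∀ d → Tup ℕ d → Tup (Fin k) d
  rem zero    _        = tt
  rem (suc d) (n , ns) = n mod k , rem d ns

  toℕ-mod : ∀ n → toℕ (n mod k) ≡ n % k
  toℕ-mod n = Fin.toℕ-fromℕ< (m%n<n n k)

  quo-rem : ∀ n → n ≡ n / k * k + toℕ (n mod k)
  quo-rem n = trans (m≡m%n+[m/n]*n n k)
    (trans (+-comm (n % k) _) (cong (n / k * k +_) (sym (toℕ-mod n))))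

  sh-quo-rem : ∀ d v → v ≡ sh d (rem d v) (quo d v)
  sh-quo-rem zero    _       = refl
  sh-quo-rem (suc d) (n , v) = cong₂ _,_ (quo-rem n) (sh-quo-rem d v)

  quo-sh : ∀ n (r : Fin k) → (n * k + toℕ r) / k ≡ n
  quo-sh n r = begin
    (n * k + toℕ r) / k      ≡⟨ +-distrib-/-∣ˡ (toℕ r) (n∣m*n n) ⟩
    n * k / k + toℕ r / k    ≡⟨ cong₂ _+_ (m*n/n≡m n k) (m<n⇒m/n≡0 (Fin.toℕ<n r)) ⟩
    n + 0                    ≡⟨ +-identityʳ n ⟩
    n                        ∎
    where open ≡-Reasoning

  rem-sh : ∀ n (r : Fin k) → (n * k + toℕ r) mod k ≡ r
  rem-sh n r = Fin.toℕ-injective (begin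
    toℕ ((n * k + toℕ r) mod k)  ≡⟨ toℕ-mod (n * k + toℕ r) ⟩
    (n * k + toℕ r) % k          ≡⟨ cong (_% k) (+-comm (n * k) (toℕ r)) ⟩
    (toℕ r + n * k) % k          ≡⟨ [m+kn]%n≡m%n (toℕ r) n k ⟩
    toℕ r % k                    ≡⟨ m<n⇒m%n≡m (Fin.toℕ<n r) ⟩
    toℕ r                        ∎)
    where open ≡-Reasoning

  sh-𝟘 : ∀ d → sh d (𝟘ᵈ d) (𝟘 d) ≡ 𝟘 d
  sh-𝟘 zero    = refl
  sh-𝟘 (suc d) = cong₂ _,_ (trans (toℕ-mod 0) (m<n⇒m%n≡m (<-trans z<s (nonTrivial⇒n>1 k)))) (sh-𝟘 d)

  /-bound : ∀ {n b} → n ≤ suc b → n / k ≤ b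
  /-bound {zero}  _  = ≤-trans (≤-reflexive (0/n≡0 k)) z≤n
  /-bound {suc n} le = ≤-pred (≤-trans (m/n<m (suc n) k (nonTrivial⇒n>1 k)) le)

  height : ∀ d → Tup ℕ d → ℕ
  height zero    _       = 0
  height (suc d) (n , v) = n ⊔ height d v

  -- Dropping the last digit of all components at once terminates because k ≥ 2: a maximum of at
  -- most b + 1 becomes at most b.
  digit-induction : ∀ d (P : Tup ℕ d → Set) → P (𝟘 d) →
                    (∀ r v → P v → P (sh d r v)) → ∀ v → P v
  digit-induction d P P𝟘 Psh v = go (height d v) v ≤-refl
    where
    height≤0 : ∀ d v → height d v ≤ 0 → v ≡ 𝟘 d
    height≤0 zero    _       _  = refl
    height≤0 (suc d) (n , v) le = cong₂ _,_
      (n≤0⇒n≡0 (m⊔n≤o⇒m≤o n _ le)) (height≤0 d v (m⊔n≤o⇒n≤o n _ le))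

    height-quo : ∀ d v {b} → height d v ≤ suc b → height d (quo d v) ≤ b
    height-quo zero    _       _  = z≤n
    height-quo (suc d) (n , v) le = ⊔-lub
      (/-bound (m⊔n≤o⇒m≤o n _ le)) (height-quo d v (m⊔n≤o⇒n≤o n _ le))

    go : ∀ b v → height d v ≤ b → P v
    go zero    v le = subst P (sym (height≤0 d v le)) P𝟘
    go (suc b) v le = subst P (sym (sh-quo-rem d v)) (Psh _ _ (go b (quo d v) (height-quo d v le)))

  -- Automaticity through the k-kernel: finitely many functions, closed under v ↦ k v + r.
  record Automatic {X : Set} d (f : Tup ℕ d → X) : Set where
    field
      size  : ℕ
      δ     : Fin size → Tup (Fin k) d → Fin size
      F     : Fin size → Tup ℕ d → X
      step  : ∀ q r v → F q (sh d r v) ≡ F (δ q r) v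
      q₀    : Fin size
      start : ∀ v → F q₀ v ≡ f v

    -- Reading all digits of v moves its information into the state and leaves 𝟘. Hence an automatic
    -- function takes only finitely many values.
    F-values : ∀ v q → ∃ λ q′ → F q v ≡ F q′ (𝟘 d)
    F-values = digit-induction d _ (λ q → q , refl)
      (λ r v ih q → let (q′ , eq) = ih (δ q r) in q′ , trans (step q r v) eq)

    values : ∀ v → ∃ λ q → f v ≡ F q (𝟘 d)
    values v = let (q , eq) = F-values v q₀ in q , trans (sym (start v)) eq

  automatic : ∀ {X Q : Set} {d} → Finite Q → (δ : Q → Tup (Fin k) d → Q) (F : Q → Tup ℕ d → X) →
              (∀ q r v → F q (sh d r v) ≡ F (δ q r) v) →
              ∀ q₀ {f} → (∀ v → F q₀ v ≡ f v) → Automatic d f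
  automatic Q δ F step q₀ start = record
    { size  = Q.size
    ; δ     = λ i r → Q.from (δ (Q.to i) r)
    ; F     = λ i → F (Q.to i)
    ; step  = λ i r v → trans (step (Q.to i) r v) (cong (λ q → F q v) (sym (Q.to-from _)))
    ; q₀    = Q.from q₀
    ; start = λ v → trans (cong (λ q → F q v) (Q.to-from q₀)) (start v)
    }
    where module Q = Finite Q

  const-automatic : ∀ {X : Set} d (x : X) → Automatic d (λ _ → x)
  const-automatic d x =
    automatic (Fin-finite {1}) (λ q _ → q) (λ _ _ → x) (λ _ _ _ → refl) zero (λ _ → refl)

  zip-automatic : ∀ {X Y Z : Set} {d f g} (h : X → Y → Z) →
                  Automatic d f → Automatic d g → Automatic d (λ v → h (f v) (g v))
  zip-automatic h A B = automatic (×-finite Fin-finite Fin-finite)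
    (λ (p , q) r → A.δ p r , B.δ q r)
    (λ (p , q) v → h (A.F p v) (B.F q v))
    (λ (p , q) r v → cong₂ h (A.step p r v) (B.step q r v))
    (A.q₀ , B.q₀) (λ v → cong₂ h (A.start v) (B.start v))
    where module A = Automatic A
          module B = Automatic B

  map-automatic : ∀ {X Y : Set} {d f} (h : X → Y) → Automatic d f → Automatic d (h ∘ f)
  map-automatic h A = zip-automatic (λ x _ → h x) A A

  -- `ρ` is polymorphic so that one rearrangement of tracks acts on numbers and on digits alike. It
  -- may permute, drop or repeat tracks; each concrete `ρ` below commutes with `sh` by `refl`.
  substitute : ∀ {X : Set} {d} e {f : Tup ℕ d → X} → Automatic d f →
               (ρ : ∀ {A} → Tup A e → Tup A d) → (∀ r v → ρ (sh e r v) ≡ sh d (ρ r) (ρ v)) →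
               Automatic e (f ∘ ρ)
  substitute {d = d} _ A ρ ρ-sh = automatic Fin-finite
    (λ q r → A.δ q (ρ r)) (λ q v → A.F q (ρ v))
    (λ q r v → trans (cong (A.F q) (ρ-sh r v)) (A.step q (ρ r) (ρ v)))
    A.q₀ (λ v → A.start (ρ v))
    where module A = Automatic A

  -- Schoolbook addition: the state (q , c) stands for `F q (c + (x + y))` with carry c. Two digits
  -- and a carry total less than 2k, so the carry stays below 2.
  sum-automatic : ∀ {X : Set} {f : Tup ℕ 1 → X} → Automatic 1 f →
                  Automatic 2 (λ (x , y , _) → f (x + y , _))
  sum-automatic A = automatic (×-finite Fin-finite (Fin-finite {2}))
    (λ (q , c) (r , s , _) → A.δ q (total c r s mod k , _) , fromℕ< (carry c r s))
    (λ (q , c) (x , y , _) → A.F q (toℕ c + (x + y) , _))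
    (λ (q , c) (r , s , _) (x , y , _) → trans
      (cong (λ n → A.F q (n , _)) (regroup c r s x y)) (A.step q _ _))
    (A.q₀ , zero) (λ v → A.start _)
    where
    module A = Automatic A

    total : Fin 2 → Fin k → Fin k → ℕ
    total c r s = toℕ c + (toℕ r + toℕ s)

    carry : ∀ c r s → total c r s / k < 2
    carry c r s = m<n*o⇒m/o<n {n = 2} (begin-strict
      toℕ c + (toℕ r + toℕ s)  <⟨ +-monoʳ-< (toℕ c) (+-mono-<-≤ (Fin.toℕ<n r) ≤-refl) ⟩
      toℕ c + (k + toℕ s)      ≤⟨ +-monoˡ-≤ _ (≤-pred (Fin.toℕ<n c)) ⟩
      1 + (k + toℕ s)          ≡⟨ +-suc k (toℕ s) ⟨
      k + suc (toℕ s)          ≤⟨ +-monoʳ-≤ k (Fin.toℕ<n s) ⟩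
      k + k                    ≡⟨ cong (k +_) (+-identityʳ k) ⟨
      2 * k                    ∎)
      where open ≤-Reasoning

    regroup : ∀ c r s x y → toℕ c + ((x * k + toℕ r) + (y * k + toℕ s)) ≡
              (toℕ (fromℕ< (carry c r s)) + (x + y)) * k + toℕ (total c r s mod k)
    regroup c r s x y = begin
      toℕ c + ((x * k + toℕ r) + (y * k + toℕ s))
        ≡⟨ solve 6 (λ c r s x y k →
             c :+ ((x :* k :+ r) :+ (y :* k :+ s)) := (x :+ y) :* k :+ (c :+ (r :+ s)))
           refl (toℕ c) (toℕ r) (toℕ s) x y k ⟩
      (x + y) * k + t
        ≡⟨ cong ((x + y) * k +_) (quo-rem t) ⟩
      (x + y) * k + (t / k * k + toℕ (t mod k))
        ≡⟨ solve 4 (λ z k u m → z :* k :+ (u :* k :+ m) := (u :+ z) :* k :+ m)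
           refl (x + y) k (t / k) (toℕ (t mod k)) ⟩
      (t / k + (x + y)) * k + toℕ (t mod k)
        ≡⟨ cong (λ u → (u + (x + y)) * k + toℕ (t mod k)) (Fin.toℕ-fromℕ< (carry c r s)) ⟨
      (toℕ (fromℕ< (carry c r s)) + (x + y)) * k + toℕ (t mod k) ∎
      where
      open ≡-Reasoning
      open +-*-Solver
      t = total c r s

  -- For odd k the last digit does not determine the parity. The affine maps n ↦ (u n + v) % 2 are
  -- closed under n ↦ n k + r, and reducing u and v modulo 2 leaves four of them; n % 2 is the one
  -- with u = 1, v = 0.
  parity-automatic : Automatic 1 (λ (n , _) → n % 2)
  parity-automatic = automatic (×-finite Fin-finite Fin-finite)
    (λ (u , v) (r , _) → (toℕ u * k) mod 2 , (toℕ u * toℕ r + toℕ v) mod 2)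
    (λ (u , v) (n , _) → (toℕ u * n + toℕ v) % 2)
    (λ (u , v) (r , _) (n , _) → affine (toℕ u) (toℕ v) n (toℕ r))
    (suc zero , zero) (λ (n , _) → cong (_% 2) (trans (+-identityʳ (1 * n)) (*-identityˡ n)))
    where
    affine : ∀ u v n r → (u * (n * k + r) + v) % 2 ≡
             (toℕ ((u * k) mod 2) * n + toℕ ((u * r + v) mod 2)) % 2
    affine u v n r = begin
      (u * (n * k + r) + v) % 2
        ≡⟨ cong (_% 2) (solve 5 (λ u v n r k →
             u :* (n :* k :+ r) :+ v := u :* k :* n :+ (u :* r :+ v)) refl u v n r k) ⟩
      (u * k * n + b) % 2
        ≡⟨ %-distribˡ-+ (u * k * n) b 2 ⟩
      (u * k * n % 2 + b % 2) % 2
        ≡⟨ cong (λ z → (z + b % 2) % 2) (%-distribˡ-* (u * k) n 2) ⟩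
      ((u * k % 2) * (n % 2) % 2 + b % 2) % 2
        ≡⟨ cong₂ (λ y z → (y * (n % 2) % 2 + z) % 2) (m%n%n≡m%n (u * k) 2) (m%n%n≡m%n b 2) ⟨
      ((u * k % 2 % 2) * (n % 2) % 2 + b % 2 % 2) % 2
        ≡⟨ cong (λ z → (z + b % 2 % 2) % 2) (%-distribˡ-* (u * k % 2) n 2) ⟨
      ((u * k % 2) * n % 2 + b % 2 % 2) % 2
        ≡⟨ %-distribˡ-+ ((u * k % 2) * n) (b % 2) 2 ⟨
      ((u * k % 2) * n + b % 2) % 2
        ≡⟨ cong₂ (λ y z → (y * n + z) % 2)
             (Fin.toℕ-fromℕ< (m%n<n (u * k) 2)) (Fin.toℕ-fromℕ< (m%n<n b 2)) ⟨
      (toℕ ((u * k) mod 2) * n + toℕ (b mod 2)) % 2 ∎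
      where
      open ≡-Reasoning
      open +-*-Solver
      b = u * r + v

  -- Closure of recognisable predicates under first-order operations.

  record Recognisable d (P : Tup ℕ d → Set) : Set where
    no-eta-equality
    pattern
    constructor _because_
    field
      decide    : Decidable P
      indicator : Automatic d (does ∘ decide)

  open Recognisable

  preimage : ∀ {X : Set} {d} {f : Tup ℕ d → X} {P : X → Set} →
             Automatic d f → Decidable P → Recognisable d (P ∘ f)
  preimage {f = f} A P? = (P? ∘ f) because map-automatic (does ∘ P?) A

  rename : ∀ {d} e {P : Tup ℕ d → Set} → Recognisable d P →
           (ρ : ∀ {A} → Tup A e → Tup A d) → (∀ r v → ρ (sh e r v) ≡ sh d (ρ r) (ρ v)) →
           Recognisable e (P ∘ ρ)
  rename e (P? because A) ρ ρ-sh = (P? ∘ ρ) because substitute e A ρ ρ-sh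

  infixr 6 _×ʳ_
  infixr 5 _→ʳ_

  ¬ʳ_ : ∀ {d P} → Recognisable d P → Recognisable d (λ v → ¬ P v)
  ¬ʳ (P? because A) = (¬? ∘ P?) because map-automatic not A

  _×ʳ_ : ∀ {d P Q} → Recognisable d P → Recognisable d Q → Recognisable d (λ v → P v × Q v)
  (P? because A) ×ʳ (Q? because B) = (λ v → P? v ×-dec Q? v) because zip-automatic _∧_ A B

  _→ʳ_ : ∀ {d P Q} → Recognisable d P → Recognisable d Q → Recognisable d (λ v → P v → Q v)
  (P? because A) →ʳ (Q? because B) = (λ v → P? v →-dec Q? v) because zip-automatic (λ p q → not p ∨ q) A B

  iff : ∀ {d P Q} → (∀ v → P v ⇔ Q v) → Recognisable d P → Recognisable d Q
  iff {d} P⇔Q (P? because A) = (λ v → map′ (to (P⇔Q v)) (from (P⇔Q v)) (P? v)) because A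
    where open Equivalence

  -- Subset construction; at v = 𝟘 the witness may have any number of digits, so a set of
  -- states meets 𝟘 iff its orbit under reading zeros on the other tracks hits an accepting set.
  ∃ʳ : ∀ {d P} → Recognisable (suc d) P → Recognisable d (λ v → ∃ λ n → P (n , v))
  ∃ʳ {d} {P} (P? because A) = P∃? because automatic (Vec-finite Bool-finite A.size) next
      (λ S v → does (meets? S v))
      (λ S r v → does-⇔ (meets-sh S r v) (meets? S (sh d r v)) (meets? (next S r) v))
      initial (λ v → does-⇔ (initial-correct v) (meets? initial v) (P∃? v))
    where
    module A = Automatic A

    States = Vec Bool A.size

    _∈_ : Fin A.size → States → Set
    q ∈ S = lookup S q ≡ true

    Meets : States → Tup ℕ d → Set
    Meets S v = ∃ λ q → q ∈ S × ∃ λ n → A.F q (n , v) ≡ true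

    next? : ∀ S r q′ → Dec (∃ λ q → q ∈ S × ∃ λ s → A.δ q (s , r) ≡ q′)
    next? S r q′ = Fin.any? λ q → lookup S q Bool.≟ true ×-dec Fin.any? λ s → A.δ q (s , r) Fin.≟ q′

    next : States → Tup (Fin k) d → States
    next S r = tabulate (λ q′ → does (next? S r q′))

    ∈-next : ∀ S r {q′} → (∃ λ q → q ∈ S × ∃ λ s → A.δ q (s , r) ≡ q′) ⇔ q′ ∈ next S r
    ∈-next S r {q′} = mk⇔
      (λ p → trans (lookup∘tabulate _ q′) (dec-true (next? S r q′) p))
      (λ p → does⇒ (next? S r q′) (trans (sym (lookup∘tabulate (λ q′ → does (next? S r q′)) q′)) p))

    -- The last digit of the witness is the digit s guessed by `next`; its quotient by k is the
    -- remaining witness.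
    meets-sh : ∀ S r v → Meets S (sh d r v) ⇔ Meets (next S r) v
    meets-sh S r v = mk⇔
      (λ (q , q∈S , n , eq) → A.δ q (n mod k , r) ,
         Equivalence.to (∈-next S r) (q , q∈S , n mod k , refl) , n / k ,
         trans (sym (A.step q _ _)) (trans (cong (λ m → A.F q (m , sh d r v)) (sym (quo-rem n))) eq))
      λ (q′ , q′∈S′ , n , eq) → let (q , q∈S , s , δq≡q′) = Equivalence.from (∈-next S r) q′∈S′ in
         q , q∈S , n * k + toℕ s ,
         trans (A.step q (s , r) (n , v)) (trans (cong (λ p → A.F p (n , v)) δq≡q′) eq)

    Accepts : States → Set
    Accepts S = ∃ λ q → q ∈ S × A.F q (𝟘 (suc d)) ≡ true

    zeros : States → States
    zeros S = next S (𝟘ᵈ d)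

    meets-𝟘 : ∀ S → Meets S (𝟘 d) ⇔ Meets (zeros S) (𝟘 d)
    meets-𝟘 S = subst (λ v → Meets S v ⇔ Meets (zeros S) (𝟘 d)) (sh-𝟘 d) (meets-sh S (𝟘ᵈ d) (𝟘 d))

    -- Induction on a bound for the witness: each reading of zeros on the other tracks strips one of
    -- its digits, until the witness is 0 and an accepting state has been reached.
    accept : ∀ b S → (∃ λ q → q ∈ S × ∃ λ n → n ≤ b × A.F q (n , 𝟘 d) ≡ true) →
             ∃ λ j → Accepts (fold S zeros j)
    accept zero S (q , q∈S , zero , _ , eq) = 0 , q , q∈S , eq
    accept (suc b) S (q , q∈S , n , n≤b , eq) =
      let (j , p) = accept b (zeros S)
            (A.δ q (n mod k , 𝟘ᵈ d) , Equivalence.to (∈-next S (𝟘ᵈ d)) (q , q∈S , n mod k , refl) ,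
             n / k , /-bound n≤b ,
             trans (sym (A.step q _ _))
               (trans (cong₂ (λ m v → A.F q (m , v)) (sym (quo-rem n)) (sh-𝟘 d)) eq))
      in suc j , subst Accepts (fold-suc S zeros j) p

    accept⁻¹ : ∀ j S → Accepts (fold S zeros j) → Meets S (𝟘 d)
    accept⁻¹ zero    S (q , q∈S , eq) = q , q∈S , 0 , eq
    accept⁻¹ (suc j) S p = Equivalence.from (meets-𝟘 S)
      (accept⁻¹ j (zeros S) (subst Accepts (sym (fold-suc S zeros j)) p))

    meets? : ∀ S v → Dec (Meets S v)
    meets? S v = digit-induction d (λ v → ∀ S → Dec (Meets S v))
      (λ S → map′ (λ (j , p) → accept⁻¹ j S p)
                  (λ (q , q∈S , n , eq) → accept n S (q , q∈S , n , ≤-refl , eq))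
                  (orbit? (Vec-finite Bool-finite A.size) zeros
                    (λ S → Fin.any? λ q → lookup S q Bool.≟ true ×-dec A.F q (𝟘 (suc d)) Bool.≟ true) S))
      (λ r v ih S → map′ (Equivalence.from (meets-sh S r v)) (Equivalence.to (meets-sh S r v))
                         (ih (next S r)))
      v S

    initial : States
    initial = tabulate (λ q → does (q Fin.≟ A.q₀))

    initial-correct : ∀ v → Meets initial v ⇔ (∃ λ n → P (n , v))
    initial-correct v = mk⇔
      (λ (q , q∈I , n , eq) → n , does⇒ (P? (n , v))
         (trans (sym (A.start (n , v))) (trans (cong (λ p → A.F p (n , v)) (sym (only q q∈I))) eq)))
      λ (n , p) → A.q₀ ,
        trans (lookup∘tabulate _ A.q₀) (dec-true (A.q₀ Fin.≟ A.q₀) refl) ,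
        n , trans (A.start (n , v)) (dec-true (P? (n , v)) p)
      where
      only : ∀ q → q ∈ initial → q ≡ A.q₀
      only q p = does⇒ (q Fin.≟ A.q₀) (trans (sym (lookup∘tabulate _ q)) p)

    P∃? : ∀ v → Dec (∃ λ n → P (n , v))
    P∃? v = map′ (Equivalence.to (initial-correct v)) (Equivalence.from (initial-correct v))
                 (meets? initial v)

  ∀ʳ : ∀ {d P} → Recognisable (suc d) P → Recognisable d (λ v → ∀ n → P (n , v))
  ∀ʳ P = iff
    (λ v → mk⇔ (λ ¬∃¬ n → decidable-stable (decide P (n , v)) (λ ¬p → ¬∃¬ (n , ¬p)))
               (λ all (n , ¬p) → ¬p (all n)))
    (¬ʳ ∃ʳ (¬ʳ P))

  -- The state is a borrow: c = 0 means x ≤ y and c = 1 means x < y. The last digits matter only if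
  -- the leading parts tie; a tie is permitted exactly when c + r ≤ s, and otherwise the leading
  -- parts must compare strictly.
  ≤-automatic : ∀ c → Automatic 2 (λ (x , y , _) → does (toℕ {2} c + x ≤? y))
  ≤-automatic c₀ = automatic (Fin-finite {2})
    (λ c (r , s , _) → borrow (toℕ c + toℕ r ≤? toℕ s))
    (λ c (x , y , _) → does (toℕ c + x ≤? y))
    (λ c (r , s , _) (x , y , _) →
       does-⇔ (lexicographic c r s (_ ≤? _) x y) (_ ≤? _) (_ ≤? _))
    c₀ (λ _ → refl)
    where
    borrow : ∀ {B} → Dec B → Fin 2
    borrow (yes _) = zero
    borrow (no _)  = suc zero

    swap : ∀ a b c → a + (b + c) ≡ b + (a + c)
    swap = solve 3 (λ a b c → a :+ (b :+ c) := b :+ (a :+ c)) refl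
      where open +-*-Solver

    lexicographic : ∀ c r s (le? : Dec (toℕ c + toℕ r ≤ toℕ s)) x y →
                    toℕ c + (x * k + toℕ r) ≤ y * k + toℕ s ⇔ toℕ (borrow le?) + x ≤ y
    lexicographic c r s (yes le) x y = mk⇔
      (λ p → ≮⇒≥ λ y<x → <-irrefl refl (begin-strict
        y * k + toℕ s            <⟨ +-monoʳ-< (y * k) (Fin.toℕ<n s) ⟩
        y * k + k                ≡⟨ +-comm (y * k) k ⟩
        suc y * k                ≤⟨ *-monoˡ-≤ k y<x ⟩
        x * k                    ≤⟨ m≤m+n (x * k) (toℕ r) ⟩
        x * k + toℕ r            ≤⟨ m≤n+m _ (toℕ c) ⟩
        toℕ c + (x * k + toℕ r)  ≤⟨ p ⟩
        y * k + toℕ s            ∎))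
      λ x≤y → begin
        toℕ c + (x * k + toℕ r)  ≡⟨ swap (toℕ c) (x * k) (toℕ r) ⟩
        x * k + (toℕ c + toℕ r)  ≤⟨ +-mono-≤ (*-monoˡ-≤ k x≤y) le ⟩
        y * k + toℕ s            ∎
      where
      open ≤-Reasoning
    lexicographic c r s (no ¬le) x y = mk⇔
      (λ p → ≰⇒> λ y≤x → <-irrefl refl (begin-strict
        y * k + toℕ s            <⟨ +-mono-≤-< (*-monoˡ-≤ k y≤x) (≰⇒> ¬le) ⟩
        x * k + (toℕ c + toℕ r)  ≡⟨ swap (toℕ c) (x * k) (toℕ r) ⟨
        toℕ c + (x * k + toℕ r)  ≤⟨ p ⟩
        y * k + toℕ s            ∎))
      λ x<y → begin
        toℕ c + (x * k + toℕ r)  ≤⟨ +-monoˡ-≤ _ (≤-pred (Fin.toℕ<n c)) ⟩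
        suc (x * k + toℕ r)      ≤⟨ +-monoʳ-< (x * k) (Fin.toℕ<n r) ⟩
        x * k + k                ≡⟨ +-comm (x * k) k ⟩
        suc x * k                ≤⟨ *-monoˡ-≤ k x<y ⟩
        y * k                    ≤⟨ m≤m+n (y * k) (toℕ s) ⟩
        y * k + toℕ s            ∎
      where
      open ≤-Reasoning

  ≤ʳ : Recognisable 2 (λ (x , y , _) → x ≤ y)
  ≤ʳ = (λ (x , y , _) → x ≤? y) because ≤-automatic zero

  <ʳ : Recognisable 2 (λ (x , y , _) → x < y)
  <ʳ = (λ (x , y , _) → suc x ≤? y) because ≤-automatic (suc zero)

  -- Recurrence, eventual truth and the pigeonhole principle.

  beyondʳ : ∀ {d P} → Recognisable (suc d) P →
            Recognisable (suc d) (λ (N , v) → ∃ λ n → N ≤ n × P (n , v))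
  beyondʳ {d} R = ∃ʳ (rename (2 + d) ≤ʳ (λ (n , N , _) → N , n , tt) (λ _ _ → refl)
                  ×ʳ rename (2 + d) R (λ (n , _ , v) → n , v) (λ _ _ → refl))

  infOftenʳ : ∀ {d P} → Recognisable (suc d) P → Recognisable d (λ v → InfOften (λ n → P (n , v)))
  infOftenʳ R = ∀ʳ (beyondʳ R)

  eventuallyʳ : ∀ {d P} → Recognisable (suc d) P →
                Recognisable d (λ v → Eventually (λ n → P (n , v)))
  eventuallyʳ {d} {P} R = ∃ʳ always
    where
    always : Recognisable (suc d) (λ (N , v) → ∀ n → N ≤ n → P (n , v))
    always = ∀ʳ (rename (2 + d) ≤ʳ (λ (n , N , _) → N , n , tt) (λ _ _ → refl)
                 →ʳ rename (2 + d) R (λ (n , _ , v) → n , v) (λ _ _ → refl))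

  -- A classical step, constructive here because both the eventual statement and the search beyond N
  -- are decidable.
  ¬infOften⇒eventually¬ : ∀ {d P} → Recognisable (suc d) P → ∀ v →
                          ¬ InfOften (λ n → P (n , v)) → Eventually (λ n → ¬ P (n , v))
  ¬infOften⇒eventually¬ R v ¬inf = decidable-stable (decide (eventuallyʳ (¬ʳ R)) v)
    λ ¬ev → ¬inf λ N → decidable-stable (decide (beyondʳ R) (N , v))
      λ ¬∃ → ¬ev (N , λ n N≤n p → ¬∃ (n , N≤n , p))

  -- If each of the finitely many values of f were eventually avoided, a common threshold would
  -- contradict `inf`. The recurring value is returned as a position p that attains it, so that
  -- later statements about it remain statements about numbers.
  infinite-pigeonhole :
    ∀ {d P} {f : Tup ℕ (suc d) → ℤ} → Automatic (suc d) f → Recognisable (suc d) P → ∀ v →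
    InfOften (λ n → P (n , v)) →
    ∃ λ p → P (p , v) × InfOften (λ n → P (n , v) × f (n , v) ≡ f (p , v))
  infinite-pigeonhole {d} {P} {f} A R v inf = select (Fin.any? λ q → decide (infOftenʳ (hits q)) v)
    where
    module A = Automatic A

    Hits : Fin A.size → Tup ℕ (suc d) → Set
    Hits q u = P u × f u ≡ A.F q (𝟘 (suc d))

    hits : ∀ q → Recognisable (suc d) (Hits q)
    hits q = R ×ʳ preimage A (ℤ._≟ A.F q (𝟘 (suc d)))

    select : Dec (∃ λ q → InfOften (λ n → Hits q (n , v))) →
             ∃ λ p → P (p , v) × InfOften (λ n → P (n , v) × f (n , v) ≡ f (p , v))
    select (yes (q , inf′)) =
      let (p , _ , Pp , fp) = inf′ 0
      in p , Pp , λ N → let (n , N≤n , Pn , fn) = inf′ N in n , N≤n , Pn , trans fn (sym fp)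
    select (no none) =
      let (N , never) = eventually-∀ A.size λ q →
            ¬infOften⇒eventually¬ (hits q) v (λ i → none (q , i))
          (n , N≤n , Pn) = inf N
          (q , eq) = A.values (n , v)
      in ⊥-elim (never n N≤n q (Pn , eq))

  -- A function with finitely many candidate values is automatic once each candidate is
  -- recognisable: take the first that applies. The default serves only arguments without a
  -- candidate.
  choose : ∀ {X : Set} {d} m {P : Fin m → Tup ℕ d → Set} → (∀ s → Recognisable d (P s)) →
           (out : Fin m → X) → X →
           Σ (Tup ℕ d → X) λ f → Automatic d f ×
             (∀ v → (∃ λ s → P s v) → ∃ λ s → f v ≡ out s × P s v)
  choose zero    R out default = (λ _ → default) , const-automatic _ default , λ { _ (() , _) }
  choose (suc m) {P} R out default with choose m (R ∘ suc) (out ∘ suc) default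
  ... | f , A , f-out =
    (λ v → if does (decide (R zero) v) then out zero else f v) ,
    zip-automatic (λ b x → if b then out zero else x) (indicator (R zero)) A ,
    correct
    where
    correct : ∀ v → (∃ λ s → P s v) →
              ∃ λ s → (if does (decide (R zero) v) then out zero else f v) ≡ out s × P s v
    correct v (s , Ps) with decide (R zero) v
    correct v (s     , Ps) | yes P0 = zero , refl , P0
    correct v (zero  , Ps) | no ¬P0 = contradiction Ps ¬P0
    correct v (suc s , Ps) | no ¬P0 = let (s′ , eq , Ps′) = f-out v (s , Ps) in suc s′ , eq , Ps′

  -- Translation between DFAOs and automatic functions.

  module _ {a : ℕ → ℤ} (M : DFAO k ℤ)
           (correct : ∀ w → a (val k w) ≡ DFAO.τ M (run (DFAO.δ M) (DFAO.q₀ M) (reverse w))) where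
    private module M = DFAO M

    digits : ℕ → ℕ → List (Fin k)
    digits zero    n = []
    digits (suc b) n = n mod k ∷ digits b (n / k)

    val-digits : ∀ b n → n ≤ b → val k (reverse (digits b n)) ≡ n
    val-digits b n n≤b = trans (List.reverse-foldl _ 0 (digits b n)) (go b n n≤b)
      where
      go : ∀ b n → n ≤ b → foldr (λ r m → m * k + toℕ r) 0 (digits b n) ≡ n
      go zero    n n≤b = sym (n≤0⇒n≡0 n≤b)
      go (suc b) n n≤b = trans (cong (λ m → m * k + toℕ (n mod k)) (go b (n / k) (/-bound n≤b)))
                               (sym (quo-rem n))

    -- M need not respect leading zeros at unreachable states, so the output is taken from
    -- the state after the last nonzero digit, kept in the second component.
    State = Fin M.m × Fin M.m

    last-nonzero : ℕ → Fin M.m → Fin M.m → Fin M.m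
    last-nonzero zero    p q = p
    last-nonzero (suc _) p q = q

    next : State → Fin k → State
    next (q , p) r = M.δ q r , last-nonzero (toℕ r) p (M.δ q r)

    output : ℕ → State → ℕ → ℤ
    output b s n = M.τ (proj₂ (foldl next s (digits b n)))

    output-0 : ∀ b s → output b s 0 ≡ M.τ (proj₂ s)
    output-0 zero    s = refl
    output-0 (suc b) s@(q , p) = begin
      output b (next s (0 mod k)) (0 / k)  ≡⟨ cong (output b (next s (0 mod k))) (0/n≡0 k) ⟩
      output b (next s (0 mod k)) 0        ≡⟨ output-0 b _ ⟩
      M.τ (last-nonzero (toℕ (0 mod k)) p _)
        ≡⟨ cong (λ r → M.τ (last-nonzero r p (M.δ q (0 mod k))))
             (trans (toℕ-mod 0) (m<n⇒m%n≡m (<-trans z<s (nonTrivial⇒n>1 k)))) ⟩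
      M.τ p                                ∎
      where open ≡-Reasoning

    -- Surplus fuel only appends zero digits, which leave the second component of the state
    -- unchanged.
    output-fuel : ∀ b c s n → n ≤ b → n ≤ c → output b s n ≡ output c s n
    output-fuel zero    c       s zero n≤b n≤c = sym (output-0 c s)
    output-fuel (suc b) zero    s zero n≤b n≤c = output-0 (suc b) s
    output-fuel (suc b) (suc c) s n    n≤b n≤c =
      output-fuel b c (next s (n mod k)) (n / k) (/-bound n≤b) (/-bound n≤c)

    output-sh : ∀ s r n → let N = n * k + toℕ r in output N s N ≡ output n (next s r) n
    output-sh s r n = begin
      output N s N                       ≡⟨ output-fuel N (suc N) s N ≤-refl (n≤1+n N) ⟩
      output N (next s (N mod k)) (N / k)
        ≡⟨ cong₂ (λ d m → output N (next s d) m) (rem-sh n r) (quo-sh n r) ⟩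
      output N (next s r) n
        ≡⟨ output-fuel N n (next s r) n (≤-trans (m≤m*n n k) (m≤m+n _ _)) ≤-refl ⟩
      output n (next s r) n              ∎
      where
      open ≡-Reasoning
      N = n * k + toℕ r

    -- The invariant is that `M.τ p` is the term of a at the number read so far. A new most
    -- significant digit 0 changes neither that number nor p; after a nonzero digit p is the state
    -- actually reached by M, where `correct` applies.
    output-correct : ∀ w u p → M.τ p ≡ a (val k (reverse u)) →
                     M.τ (proj₂ (foldl next (run M.δ M.q₀ u , p) w)) ≡ a (val k (reverse (u ++ w)))
    output-correct []      u p τp = trans τp (cong (a ∘ val k ∘ reverse) (sym (List.++-identityʳ u)))
    output-correct (r ∷ w) u p τp = begin
      M.τ (proj₂ (foldl next (q′ , p′) w))
        ≡⟨ cong (λ q → M.τ (proj₂ (foldl next (q , p′) w))) (List.foldl-∷ʳ M.δ M.q₀ r u) ⟨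
      M.τ (proj₂ (foldl next (run M.δ M.q₀ (u ++ [ r ]) , p′) w))
        ≡⟨ output-correct w (u ++ [ r ]) p′ (τp′ (toℕ r) refl) ⟩
      a (val k (reverse ((u ++ [ r ]) ++ w)))
        ≡⟨ cong (a ∘ val k ∘ reverse) (List.∷ʳ-++ u r w) ⟩
      a (val k (reverse (u ++ r ∷ w))) ∎
      where
      open ≡-Reasoning
      q′ = M.δ (run M.δ M.q₀ u) r
      p′ = last-nonzero (toℕ r) p q′

      τp′ : ∀ n → toℕ r ≡ n → M.τ (last-nonzero n p q′) ≡ a (val k (reverse (u ++ [ r ])))
      τp′ zero r≡0 = begin
        M.τ p                                  ≡⟨ τp ⟩
        a (val k (reverse u))
          ≡⟨ cong (λ d → a (foldl (λ m d → m * k + toℕ d) d (reverse u))) r≡0 ⟨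
        a (val k (r ∷ reverse u))              ≡⟨ cong (a ∘ val k) (List.reverse-++ u [ r ]) ⟨
        a (val k (reverse (u ++ [ r ])))       ∎
      τp′ (suc _) _ = begin
        M.τ q′                                 ≡⟨ cong M.τ (List.foldl-∷ʳ M.δ M.q₀ r u) ⟨
        M.τ (run M.δ M.q₀ (u ++ [ r ]))
          ≡⟨ cong (M.τ ∘ run M.δ M.q₀) (List.reverse-involutive (u ++ [ r ])) ⟨
        M.τ (run M.δ M.q₀ (reverse (reverse (u ++ [ r ]))))
                                               ≡⟨ correct (reverse (u ++ [ r ])) ⟨
        a (val k (reverse (u ++ [ r ])))       ∎

    DFAO⇒automatic : Automatic 1 (λ (n , _) → a n)
    DFAO⇒automatic = automatic (×-finite Fin-finite Fin-finite)
      (λ s (r , _) → next s r) (λ s (n , _) → output n s n)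
      (λ s (r , _) (n , _) → output-sh s r n)
      (M.q₀ , M.q₀)
      (λ (n , _) → trans (output-correct (digits n n) [] M.q₀ (sym (correct [])))
                         (cong a (val-digits n n ≤-refl)))

  -- Once all digits are read the remaining argument is 0, whence the output `A.F q 0`. As `step`
  -- holds for a zero digit at 0 as well, leading zeros need no separate treatment.
  automatic⇒DFAO : ∀ {y : ℕ → ℤ} → Automatic 1 (λ (n , _) → y n) → IsAutomatic k y
  automatic⇒DFAO {y} A = M , λ w → begin
      y (val k w)
        ≡⟨ cong (y ∘ val k) (List.reverse-involutive w) ⟨
      y (val k (reverse (reverse w)))
        ≡⟨ cong y (List.reverse-foldl _ 0 (reverse w)) ⟩
      y (lsd-value (reverse w))
        ≡⟨ A.start _ ⟨
      A.F A.q₀ (lsd-value (reverse w) , _)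
        ≡⟨ F-run (reverse w) A.q₀ ⟩
      A.F (run (DFAO.δ M) A.q₀ (reverse w)) (0 , _) ∎
    where
    open ≡-Reasoning
    module A = Automatic A

    M : DFAO k ℤ
    M = record { m = A.size ; δ = λ q r → A.δ q (r , _) ; q₀ = A.q₀ ; τ = λ q → A.F q (0 , _) }

    lsd-value : List (Fin k) → ℕ
    lsd-value = foldr (λ r n → n * k + toℕ r) 0

    F-run : ∀ u q → A.F q (lsd-value u , _) ≡ A.F (run (DFAO.δ M) q u) (0 , _)
    F-run []      q = refl
    F-run (r ∷ u) q = trans (A.step q (r , _) (lsd-value u , _)) (F-run u (A.δ q (r , _)))

  -- The liminf of the shifts for a parity-dependent letter order.

  module Extremal
    (compare : ℕ → ℤ → ℤ → Set) (isSTO : ∀ p → IsStrictTotalOrder _≡_ (compare p))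
    (a : ℕ → ℤ) (a-automatic : Automatic 1 (λ (n , _) → a n)) where

    open Lexicographic (λ x t y → compare (t % 2) x y) (isSTO ∘ (_% 2)) public

    letter : Automatic 2 (λ (i , t , _) → a (i + t))
    letter = sum-automatic a-automatic

    letters : Automatic 3 (λ (i , j , t , _) → a (i + t) , a (j + t))
    letters = zip-automatic _,_
      (substitute 3 letter (λ (i , j , t , _) → i , t , tt) (λ _ _ → refl))
      (substitute 3 letter (λ (i , j , t , _) → j , t , tt) (λ _ _ → refl))

    ≡ʳ : Recognisable 3 (λ (i , j , t , _) → a (i + t) ≡ a (j + t))
    ≡ʳ = preimage {P = λ (x , y) → x ≡ y} letters (λ (x , y) → x ℤ.≟ y)

    ≺ʳ : Recognisable 3 (λ (i , j , t , _) → compare (t % 2) (a (i + t)) (a (j + t)))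
    ≺ʳ = preimage {P = λ (p , x , y) → compare p x y}
      (zip-automatic _,_
        (substitute 3 parity-automatic (λ (i , j , t , _) → t , tt) (λ _ _ → refl)) letters)
      (λ (p , x , y) → IsStrictTotalOrder._<?_ (isSTO p) x y)

    agreeʳ : Recognisable 3 (λ (i , j , n , _) → Agree (shift i a) (shift j a) n)
    agreeʳ = ∀ʳ (rename 4 <ʳ (λ (t , i , j , n , _) → t , n , tt) (λ _ _ → refl)
                 →ʳ rename 4 ≡ʳ (λ (t , i , j , n , _) → i , j , t , tt) (λ _ _ → refl))

    lessʳ : Recognisable 3 (λ (i , j , n , _) → Less (shift i a) (shift j a) n)
    lessʳ = ∃ʳ (rename 4 <ʳ (λ (t , i , j , n , _) → t , n , tt) (λ _ _ → refl)
                ×ʳ rename 4 agreeʳ (λ (t , i , j , n , _) → i , j , t , tt) (λ _ _ → refl)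
                ×ʳ rename 4 ≺ʳ (λ (t , i , j , n , _) → i , j , t , tt) (λ _ _ → refl))

    -- The second half demands that smaller factors eventually disappear, not just that no single
    -- one recurs: this is the threshold that `IsLiminfT` asks for.
    IsLiminfPrefix : Seq → ℕ → Set
    IsLiminfPrefix u n = InfOften (λ j → Agree u (shift j a) n)
                         × Eventually (λ j → ¬ Less (shift j a) u n)

    isLiminfPrefixʳ : Recognisable 2 (λ (i , n , _) → IsLiminfPrefix (shift i a) n)
    isLiminfPrefixʳ =
      infOftenʳ (rename 3 agreeʳ (λ (j , i , n , _) → i , j , n , tt) (λ _ _ → refl))
      ×ʳ eventuallyʳ (¬ʳ rename 3 lessʳ (λ (j , i , n , _) → j , i , n , tt) (λ _ _ → refl))

    -- The letter `a (p + n)` is a candidate for the next letter of the liminf, represented by the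
    -- position p so that the minimum over candidates is a first-order notion.
    Extends : ℕ → ℕ → ℕ → Set
    Extends i n p = Agree (shift i a) (shift p a) n ×
      InfOften (λ j → Agree (shift i a) (shift j a) n × a (j + n) ≡ a (p + n))

    agreeing : Recognisable 3 (λ (j , i , n , _) → Agree (shift i a) (shift j a) n)
    agreeing = rename 3 agreeʳ (λ (j , i , n , _) → i , j , n , tt) (λ _ _ → refl)

    extendsʳ : Recognisable 3 (λ (p , i , n , _) → Extends i n p)
    extendsʳ = agreeing ×ʳ infOftenʳ
      (rename 4 agreeing (λ (j , p , i , n , _) → j , i , n , tt) (λ _ _ → refl)
       ×ʳ rename 4 ≡ʳ (λ (j , p , i , n , _) → j , p , n , tt) (λ _ _ → refl))

    smallerʳ : Recognisable 3 (λ (q , i , n , _) →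
                 ∃ λ p → Extends i n p × compare (n % 2) (a (p + n)) (a (q + n)))
    smallerʳ = ∃ʳ (rename 4 extendsʳ (λ (p , q , i , n , _) → p , i , n , tt) (λ _ _ → refl)
                   ×ʳ rename 4 ≺ʳ (λ (p , q , i , n , _) → p , q , n , tt) (λ _ _ → refl))

    belowʳ : Recognisable 4 (λ (j , p , i , n , _) →
               Agree (shift i a) (shift j a) n × compare (n % 2) (a (j + n)) (a (p + n)))
    belowʳ = rename 4 agreeing (λ (j , p , i , n , _) → j , i , n , tt) (λ _ _ → refl)
             ×ʳ rename 4 ≺ʳ (λ (j , p , i , n , _) → j , p , n , tt) (λ _ _ → refl)

    -- A smaller factor at a late position cannot differ within the first n letters, by the
    -- assumption on i, so it is smaller at index n. Were this to happen infinitely often, some such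
    -- letter would recur by the pigeonhole principle and be a smaller candidate than that of p.
    extend-minimal : ∀ i n p → Eventually (λ j → ¬ Less (shift j a) (shift i a) n) → Extends i n p →
                     ¬ (∃ λ q → Extends i n q × compare (n % 2) (a (q + n)) (a (p + n))) →
                     IsLiminfPrefix (shift p a) (suc n)
    extend-minimal i n p (N , never) (ip , inf-p) minimal = infinitely , eventually never-below
      where
      infinitely : InfOften (λ j → Agree (shift p a) (shift j a) (suc n))
      infinitely M = let (j , M≤j , ij , eq) = inf-p M in
        j , M≤j , agree-suc (agree-trans (agree-sym ip) ij) (sym eq)

      Below : ℕ → Set
      Below j = Agree (shift i a) (shift j a) n × compare (n % 2) (a (j + n)) (a (p + n))

      never-below : Eventually (λ j → ¬ Below j)
      never-below = ¬infOften⇒eventually¬ belowʳ (p , i , n , tt) λ inf-below →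
        contradicts-minimality (infinite-pigeonhole
          (substitute 4 letter (λ (j , p , i , n , _) → j , n , tt) (λ _ _ → refl))
          belowʳ (p , i , n , tt) inf-below)
        where
        contradicts-minimality : ¬ (∃ λ q → Below q × InfOften (λ j → Below j × a (j + n) ≡ a (q + n)))
        contradicts-minimality (q , (iq , lt) , inf-q) =
          minimal (q , (iq , λ M → let (j , M≤j , (ij , _) , eq) = inf-q M in j , M≤j , ij , eq) , lt)

      eventually : Eventually (λ j → ¬ Below j) →
                   Eventually (λ j → ¬ Less (shift j a) (shift p a) (suc n))
      eventually (N′ , never′) = N ⊔ N′ , λ j le lt → excluded j le (less-suc lt)
        where
        excluded : ∀ j → N ⊔ N′ ≤ j →
                   ¬ (Less (shift j a) (shift p a) n ⊎
                      Agree (shift j a) (shift p a) n × compare (n % 2) (a (j + n)) (a (p + n)))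
        excluded j le (inj₁ lt)        =
          never j (m⊔n≤o⇒m≤o N N′ le) (less-respʳ (agree-sym ip) lt)
        excluded j le (inj₂ (jp , lt)) =
          never′ j (m⊔n≤o⇒n≤o N N′ le) (agree-trans ip (agree-sym jp) , lt)

    extend : ∀ i n → IsLiminfPrefix (shift i a) n → ∃ λ p → IsLiminfPrefix (shift p a) (suc n)
    extend i n (inf , never) = conclude
      (minimum n (λ q → Automatic.F a-automatic q (0 , _)) (λ p → a (p + n))
        (λ p → Automatic.values a-automatic (p + n , _))
        (Extends i n) (λ q → decide smallerʳ (q , i , n , tt))
        -- Some letter follows the recurring prefix infinitely often, so the descent has a candidate
        -- to start from.
        (infinite-pigeonhole
          (substitute 3 letter (λ (j , i , n , _) → j , n , tt) (λ _ _ → refl))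
          agreeing (i , n , tt) inf))
      where
      conclude : (∃ λ p → Extends i n p ×
                   ¬ (∃ λ q → Extends i n q × compare (n % 2) (a (q + n)) (a (p + n)))) →
                 ∃ λ p → IsLiminfPrefix (shift p a) (suc n)
      conclude (p , ext , minimal) = p , extend-minimal i n p never ext minimal

    -- Abstract, since unfolding would run the decision procedures.
    abstract
      liminfPrefix : ∀ n → ∃ λ i → IsLiminfPrefix (shift i a) n
      liminfPrefix zero    = 0 , (λ N → N , ≤-refl , λ _ ()) , 0 , λ { _ _ (_ , () , _) }
      liminfPrefix (suc n) = let (i , p) = liminfPrefix n in extend i n p

    isLiminfPrefix-≤ : ∀ {u m n} → m ≤ n → IsLiminfPrefix u n → IsLiminfPrefix u m
    isLiminfPrefix-≤ m≤n (inf , N , never) =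
      (λ M → let (j , M≤j , uj) = inf M in j , M≤j , agree-≤ m≤n uj) ,
      N , λ j N≤j lt → never j N≤j (less-≤ m≤n lt)

    -- If one prefix were smaller, its recurrences beyond the threshold of the other would
    -- contradict the minimality of the latter.
    isLiminfPrefix-unique : ∀ {u v n} → IsLiminfPrefix u n → IsLiminfPrefix v n → Agree u v n
    isLiminfPrefix-unique {u} {v} {n} (inf-u , N , never-u) (inf-v , M , never-v)
      with trichotomy u v n
    ... | inj₁ uv        = uv
    ... | inj₂ (inj₁ lt) = let (j , M≤j , uj) = inf-u M in
                           contradiction (less-respˡ uj lt) (never-v j M≤j)
    ... | inj₂ (inj₂ gt) = let (j , N≤j , vj) = inf-v N in
                           contradiction (less-respˡ vj gt) (never-u j N≤j)

    isLiminfPrefix-resp : ∀ {u v n} → Agree u v n → IsLiminfPrefix u n → IsLiminfPrefix v n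
    isLiminfPrefix-resp uv (inf , N , never) =
      (λ M → let (j , M≤j , uj) = inf M in j , M≤j , agree-trans (agree-sym uv) uj) ,
      N , λ j N≤j lt → never j N≤j (less-respʳ (agree-sym uv) lt)

    -- Any length m above n serves, since all these prefixes agree at index n. This keeps the
    -- successor function out of the formula.
    IsLiminfLetter : ℤ → ℕ → Set
    IsLiminfLetter x n = ∃ λ m → ∃ λ i → n < m × IsLiminfPrefix (shift i a) m × a (i + n) ≡ x

    isLiminfLetterʳ : ∀ x → Recognisable 1 (λ (n , _) → IsLiminfLetter x n)
    isLiminfLetterʳ x = ∃ʳ atPosition
      where
      atPosition : Recognisable 2 (λ (m , n , _) →
                     ∃ λ i → n < m × IsLiminfPrefix (shift i a) m × a (i + n) ≡ x)
      atPosition = ∃ʳ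
        (rename 3 <ʳ (λ (i , m , n , _) → n , m , tt) (λ _ _ → refl)
         ×ʳ rename 3 isLiminfPrefixʳ (λ (i , m , n , _) → i , m , tt) (λ _ _ → refl)
         ×ʳ preimage (substitute 3 letter (λ (i , m , n , _) → i , n , tt) (λ _ _ → refl)) (ℤ._≟ x))

    abstract
      liminf : ∃ λ y → Automatic 1 (λ (n , _) → y n) × (∀ n → IsLiminfPrefix y n)
      liminf = y , proj₁ (proj₂ letters-of-y) , y-prefix
        where
        value : Fin (Automatic.size a-automatic) → ℤ
        value q = Automatic.F a-automatic q (0 , _)

        letters-of-y : Σ (Tup ℕ 1 → ℤ) λ f → Automatic 1 f ×
          (∀ v → (∃ λ q → IsLiminfLetter (value q) (proj₁ v)) →
                 ∃ λ q → f v ≡ value q × IsLiminfLetter (value q) (proj₁ v))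
        -- The default 0ℤ is never selected: `y-letter` exhibits a qualifying value at every index.
        letters-of-y = choose _ (isLiminfLetterʳ ∘ value) value 0ℤ

        y : Seq
        y n = proj₁ letters-of-y (n , _)

        y-letter : ∀ n → IsLiminfLetter (y n) n
        y-letter n =
          let (i , p)        = liminfPrefix (suc n)
              (q , eq)       = Automatic.values a-automatic (i + n , _)
              (q′ , eq′ , l) = proj₂ (proj₂ letters-of-y) (n , _) (q , suc n , i , ≤-refl , p , eq)
          in subst (λ x → IsLiminfLetter x n) (sym eq′) l

        y-prefix : ∀ n → IsLiminfPrefix y n
        y-prefix n = let (i , p) = liminfPrefix n in
          -- At index t both prefixes, of lengths n and m, are cut to length t + 1, where uniqueness
          -- identifies them.
          isLiminfPrefix-resp (λ t t<n → let (m , j , t<m , p′ , eq) = y-letter t in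
            trans (isLiminfPrefix-unique (isLiminfPrefix-≤ t<n p) (isLiminfPrefix-≤ t<m p′) t ≤-refl) eq) p

    module _ {y : Seq} (y-prefix : ∀ n → IsLiminfPrefix y n) where

      -- Past the threshold for length t + 1, a shift either shares the first t + 1 letters of y,
      -- and z stays below it at index t, or lies above y already.
      eventually-above : ∀ z → z ⊏ y → Eventually (λ j → z ⊏ shift j a)
      eventually-above z z⊏y@(t , zy , lt) =
        let (_ , N , never) = y-prefix (suc t) in N , λ j N≤j → above j (never j N≤j)
        where
        above : ∀ j → ¬ Less (shift j a) y (suc t) → z ⊏ shift j a
        above j ¬less with trichotomy (shift j a) y (suc t)
        ... | inj₁ jy          = t , agree-trans zy (agree-sym (agree-≤ (n≤1+n t) jy)) ,
                                 subst (compare (t % 2) (z t)) (sym (jy t ≤-refl)) lt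
        ... | inj₂ (inj₁ jy) = contradiction jy ¬less
        ... | inj₂ (inj₂ yj) = ⊏-less-trans z⊏y yj

      infOften-below : ∀ z → y ⊏ z → InfOften (λ j → shift j a ⊏ z)
      infOften-below z (t , yz , lt) N =
        let (j , N≤j , yj) = proj₁ (y-prefix (suc t)) N in
        j , N≤j , t , agree-trans (agree-sym (agree-≤ (n≤1+n t) yj)) yz ,
        subst (λ x → compare (t % 2) x (z t)) (yj t ≤-refl) lt

      -- The index j + t is at least t, so positivity of the partial quotients from index 1 on
      -- passes to y, and so does the bound.
      letter-occurs : ∀ t → ∃ λ j → y t ≡ a (j + t)
      letter-occurs t = let (j , _ , yj) = proj₁ (y-prefix (suc t)) 0 in j , yj t ≤-refl

      isCF : IsCF a → IsCF y
      isCF cf t 1≤t = let (j , eq) = letter-occurs t in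
        subst (_ ≤ℤ_) (sym eq) (cf (j + t) (≤-trans 1≤t (m≤n+m t j)))

      bounded : Bounded a → Bounded y
      bounded (B , bound) = B , λ t → let (j , eq) = letter-occurs t in
        subst (λ x → ∣ x ∣ ≤ B) (sym eq) (bound (j + t))

-- Names the comparison at index i that is local to _<cf_.
LtAt : (u v : ℕ → ℤ) → ℕ → Set
LtAt u v = second (u <cf v) refl
  where
  second : ∀ {A B : ℕ → Set} (S : Set) → S ≡ (∃ λ i → A i × B i) → ℕ → Set
  second {B = B} _ _ = B

-- The order of continued fractions as a parity-dependent comparison.

cf-compare : ℕ → ℤ → ℤ → Set
cf-compare zero    = _<ℤ_
cf-compare (suc _) = flip _<ℤ_

cf-compare-isStrictTotalOrder : ∀ p → IsStrictTotalOrder _≡_ (cf-compare p)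
cf-compare-isStrictTotalOrder zero    = ℤ.<-isStrictTotalOrder
cf-compare-isStrictTotalOrder (suc _) = Flip.isStrictTotalOrder ℤ.<-isStrictTotalOrder

LtAt≡compare : ∀ u v t → LtAt u v t ≡ cf-compare (t % 2) (u t) (v t)
LtAt≡compare u v t with t % 2
... | zero  = refl
... | suc _ = refl

theorem7 : (k : ℕ) → 2 ≤ k → (a : ℕ → ℤ) → IsCF a → AutomaticCF k a →
    (∃ λ y → IsCF y × IsLiminfT a y × AutomaticCF k y)
    × (∃ λ y → IsCF y × IsLimsupT a y × AutomaticCF k y)
theorem7 k 2≤k a cf (a-bounded , M , correct) = infimum Inf.liminf , supremum Sup.liminf
  where
  open Automata k {{n>1⇒nonTrivial 2≤k}}

  module Inf = Extremal cf-compare cf-compare-isStrictTotalOrder a (DFAO⇒automatic M correct)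
  -- The limsup is the liminf for the reversed order.
  module Sup = Extremal (flip ∘ cf-compare)
    (Flip.isStrictTotalOrder ∘ cf-compare-isStrictTotalOrder) a (DFAO⇒automatic M correct)

  from : ∀ {u v} → u <cf v → u Inf.⊏ v
  from {u} {v} (t , uv , lt) = t , uv , subst (λ S → S) (LtAt≡compare u v t) lt

  to : ∀ {u v} → u Inf.⊏ v → u <cf v
  to {u} {v} (t , uv , lt) = t , uv , subst (λ S → S) (sym (LtAt≡compare u v t)) lt

  -- Exchanging the two sequences and reversing every letter order cancel out, so the index of first
  -- difference is kept.
  from′ : ∀ {u v} → u <cf v → v Sup.⊏ u
  from′ u<v = let (t , uv , lt) = from u<v in t , Sup.agree-sym uv , lt

  to′ : ∀ {u v} → v Sup.⊏ u → u <cf v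
  to′ (t , vu , lt) = to (t , Sup.agree-sym vu , lt)

  infimum : (∃ λ y → Automatic 1 (λ (n , _) → y n) × (∀ n → Inf.IsLiminfPrefix y n)) →
            ∃ λ y → IsCF y × IsLiminfT a y × AutomaticCF k y
  infimum (y , A , prefix) = y , Inf.isCF prefix cf ,
    ((λ z _ z<y → let (N , f) = Inf.eventually-above prefix z (from z<y) in
        N , λ n N≤n → to (f n N≤n)) ,
     (λ z _ y<z N → let (n , N≤n , lt) = Inf.infOften-below prefix z (from y<z) N in
        n , N≤n , to lt)) ,
    Inf.bounded prefix a-bounded , automatic⇒DFAO A

  supremum : (∃ λ y → Automatic 1 (λ (n , _) → y n) × (∀ n → Sup.IsLiminfPrefix y n)) →
             ∃ λ y → IsCF y × IsLimsupT a y × AutomaticCF k y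
  supremum (y , A , prefix) = y , Sup.isCF prefix cf ,
    ((λ z _ y<z → let (N , f) = Sup.eventually-above prefix z (from′ y<z) in
        N , λ n N≤n → to′ (f n N≤n)) ,
     (λ z _ z<y N → let (n , N≤n , lt) = Sup.infOften-below prefix z (from′ z<y) N in
        n , N≤n , to′ lt)) ,
    Sup.bounded prefix a-bounded , automatic⇒DFAO A
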